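{- Let $n \ge 5$, let $T$ be a tree with vertex set $\{1,2,\ldots,n\}$, and let $\Gamma$ be the Cayley graph of $S_n$ generated by the transpositions $(i,j)$ such that $ij$ is an edge of $T$. Let $\beta_{\max}$ be the maximum possible value returned by Algorithm A for input $T$, over all possible choices of vertex pairs in its step A2. Then $$\mathrm{diam}(\Gamma) ~\le~ \beta_{\max}~ \le~ \max_{\pi \in S_n} \left\{c(\pi)-n+\sum_{i=1}^n \mathrm{dist}_T(i,\pi(i)) \right\}.$$
   Context: $S_n$ is the symmetric group on $\{1,\ldots,n\}$; the product $\pi\tau$ means apply $\tau$ first, then $\pi$. For a tree $T$ on vertex set $\{1,\ldots,n\}$ (a transposition tree), each edge $ij$ is identified with the transposition $(i,j)$, and the Cayley graph $\Gamma$ generated by $T$ is the simple undirected graph with vertex set $S_n$ in which $g$ and $h$ are adjacent iff $h = gs$ for some transposition $s$ that is an edge of $T$. $\mathrm{dist}_G$ and $\mathrm{diam}(G)$ denote distance and diameter in a graph $G$. $c(\pi)$ is the number of cycles of $\pi$, including cycles of length 1. Algorithm A (input: a tree $T$; output: a number $\beta$). A1. Set $\beta \leftarrow 0$. A2. Find any two vertices $i,j$ of the current tree $T$ such that $\mathrm{dist}_T(i,j)=\mathrm{diam}(T)$. A3. Set $\beta \leftarrow \beta+(2\,\mathrm{diam}(T)-1)$ (with $T$ the current tree), and then set $T \leftarrow T-\{i,j\}$ (delete the vertices $i,j$). If $T$ still has 3 or more vertices, return to step A2; otherwise, set $\beta \leftarrow \beta+|V(T)|-1$ and terminate with output $\beta$.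 The output can depend on the choices of vertex pairs made in step A2; $\mathcal{B}$ denotes the set of all possible outputs for the given input $T$, and $\beta_{\max} := \max_{\beta \in \mathcal{B}} \beta$. -}

module Defs where

open import Data.Fin using (Fin; zero; suc; inject₁; fromℕ)
open import Data.Fin.Permutation using (Permutation′; _⟨$⟩ʳ_; _⟨$⟩ˡ_; _∘ₚ_; transpose; inverseˡ)
  renaming (_≈_ to _≈ₚ_)
open import Data.Fin.Permutation.Components using (transpose-inverse)
open import Data.Fin.Properties using (_≟_)
open import Data.Fin.Subset using (Subset; _∈_; _-_; ∣_∣; ⊤)
open import Data.Integer as ℤ using (ℤ; +_)
open import Data.List using (sum; tabulate)
open import Data.Nat using (ℕ; zero; suc; _+_; _*_; _∸_; _≤_; _<_)
open import Data.Nat.GeneralisedArithmetic using (iterate)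
open import Data.Product using (∃; ∃₂; _×_; _,_; proj₁)
open import Function using (_⇔_)
open import Function.Definitions using (Injective; Surjective)
open import Level using (0ℓ)
open import Relation.Binary using (Rel; Setoid; Decidable; Irreflexive; Symmetric; _Respects₂_)
open import Relation.Binary.Construct.On as On using ()
open import Relation.Binary.PropositionalEquality as ≡ using (_≡_; refl; cong; sym; trans)
open import Relation.Nullary using (¬_)
open import Relation.Nullary.Decidable using (dec-true)

-- Vertices form a setoid because permutations are compared pointwise and
-- vertices of an induced subgraph by their underlying vertex.
record Graph (V : Setoid 0ℓ 0ℓ) : Set₁ where
  open Setoid V using (Carrier; _≈_)
  field
    Adj    : Rel Carrier 0ℓ
    resp   : Adj Respects₂ _≈_
    symm   : Symmetric Adj
    irrefl : Irreflexive _≈_ Adj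

module _ {V : Setoid 0ℓ 0ℓ} (G : Graph V) where
  open Setoid V using (Carrier; _≈_)
  open Graph G

  data Walk : ℕ → Carrier → Carrier → Set where
    nil  : ∀ {u v} → u ≈ v → Walk 0 u v
    cons : ∀ {k u w v} → Adj u w → Walk k w v → Walk (suc k) u v

  IsDist : Carrier → Carrier → ℕ → Set
  IsDist u v d = Walk d u v × (∀ {k} → Walk k u v → d ≤ k)

  -- Only a connected graph has a diameter in this sense.
  IsDiam : ℕ → Set
  IsDiam D = (∀ u v → ∃ λ d → IsDist u v d × d ≤ D)
           × (∃₂ λ u v → IsDist u v D)

  Connected : Set
  Connected = ∀ u v → ∃ λ k → Walk k u v

  -- A cycle on the 3 + k distinct vertices c 0, …, c (2 + k).
  Cycle : Set
  Cycle = ∃ λ k → ∃ λ (c : Fin (3 + k) → Carrier) →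
      Injective _≡_ _≈_ c
    × (∀ (i : Fin (2 + k)) → Adj (c (inject₁ i)) (c (suc i)))
    × Adj (c (fromℕ (2 + k))) (c zero)

  Acyclic : Set
  Acyclic = ¬ Cycle

-- adj? is automatic classically; constructively it says that T is a finite
-- combinatorial object given by its edges.
record Tree (n : ℕ) : Set₁ where
  field
    graph     : Graph (≡.setoid (Fin n))
    adj?      : Decidable (Graph.Adj graph)
    connected : Connected graph
    acyclic   : Acyclic graph

induced : ∀ {n} → Graph (≡.setoid (Fin n)) → (U : Subset n) →
          Graph (On.setoid (≡.setoid (Fin n)) (proj₁ {B = _∈ U}))
induced G U = record
  { Adj    = λ u v → Adj (proj₁ u) (proj₁ v)
  ; resp   = (λ { refl a → a }) , (λ { refl a → a })
  ; symm   = symm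
  ; irrefl = irrefl
  }
  where open Graph G

Sym : ℕ → Setoid 0ℓ 0ℓ
Sym n = record
  { Carrier       = Permutation′ n
  ; _≈_           = _≈ₚ_
  ; isEquivalence = record
    { refl  = λ _ → refl
    ; sym   = λ p i → sym (p i)
    ; trans = λ p q i → trans (p i) (q i)
    }
  }

-- The product g s applies s first; in the library's diagrammatic order this
-- is s ∘ₚ g.
cayley : ∀ {n} → Graph (≡.setoid (Fin n)) → Graph (Sym n)
cayley {n} G = record
  { Adj    = CAdj
  ; resp   = (λ { p (i , j , a , q) → i , j , a , λ x → trans (sym (p x)) (q x) })
           , (λ { p (i , j , a , q) → i , j , a , λ x → trans (q x) (p (transpose i j ⟨$⟩ʳ x)) })
  ; symm   = λ { {g} {h} (i , j , a , q) → j , i , symm a , λ x →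
               trans (cong (g ⟨$⟩ʳ_) (sym (transpose-inverse i j)))
                     (sym (q (transpose j i ⟨$⟩ʳ x))) }
  ; irrefl = λ { {g} {h} p (i , j , a , q) → irrefl (inj g (trans (p i) (trans (q i)
               (cong (g ⟨$⟩ʳ_) (transpose-fst i j))))) a }
  }
  where
  open Graph G

  CAdj : Rel (Permutation′ n) 0ℓ
  CAdj g h = ∃₂ λ i j → Adj i j × h ≈ₚ (transpose i j ∘ₚ g)

  transpose-fst : ∀ (i j : Fin n) → transpose i j ⟨$⟩ʳ i ≡ j
  transpose-fst i j rewrite dec-true (i ≟ i) refl = refl

  inj : ∀ (g : Permutation′ n) {i j} → g ⟨$⟩ʳ i ≡ g ⟨$⟩ʳ j → i ≡ j
  inj g e = trans (sym (inverseˡ g)) (trans (cong (g ⟨$⟩ˡ_) e) (inverseˡ g))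

IsMaximum : {A : Set} → Rel A 0ℓ → (A → Set) → A → Set
IsMaximum _≤′_ P m = P m × (∀ x → P x → x ≤′ m)

-- Run T U β b: from step A2 with current tree the subgraph of T induced by U
-- and current value β, the algorithm can terminate with output b.  The
-- truncated subtractions are exact: a tree on at least 3 vertices has diameter
-- at least 2, and deleting two of its vertices leaves at least one.
data Run {n} (T : Tree n) (U : Subset n) (β : ℕ) : ℕ → Set where
  loop : ∀ {i j d b} (i∈U : i ∈ U) (j∈U : j ∈ U) →
         IsDiam (induced (Tree.graph T) U) d →
         IsDist (induced (Tree.graph T) U) (i , i∈U) (j , j∈U) d →
         3 ≤ ∣ U - i - j ∣ →
         Run T (U - i - j) (β + (2 * d ∸ 1)) b →
         Run T U β b
  stop : ∀ {i j d} (i∈U : i ∈ U) (j∈U : j ∈ U) →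
         IsDiam (induced (Tree.graph T) U) d →
         IsDist (induced (Tree.graph T) U) (i , i∈U) (j , j∈U) d →
         ∣ U - i - j ∣ < 3 →
         Run T U β (β + (2 * d ∸ 1) + (∣ U - i - j ∣ ∸ 1))

Output : ∀ {n} → Tree n → ℕ → Set
Output T = Run T ⊤ 0

SameCycle : ∀ {n} → Permutation′ n → Rel (Fin n) 0ℓ
SameCycle π i j = ∃ λ k → iterate (π ⟨$⟩ʳ_) i k ≡ j

-- The cycles of π are the classes of SameCycle π, fixed points included; cyc
-- exhibits Fin c as the quotient, so there are exactly c of them.
HasCycles : ∀ {n} → Permutation′ n → ℕ → Set
HasCycles {n} π c = ∃ λ (cyc : Fin n → Fin c) →
    Surjective _≡_ _≡_ cyc
  × (∀ i j → cyc i ≡ cyc j ⇔ SameCycle π i j)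

BoundValue : ∀ {n} → Tree n → ℤ → Set
BoundValue {n} T v = ∃ λ (π : Permutation′ n) → ∃ λ c → ∃ λ (d : Fin n → ℕ) →
    HasCycles π c
  × (∀ i → IsDist (Tree.graph T) i (π ⟨$⟩ʳ i) (d i))
  × v ≡ + c ℤ.- + n ℤ.+ + sum (tabulate d)

-- In a tree the two ends of a longest path are leaves, since two neighbours of
-- an end would be joined by a path avoiding it, which closes a cycle.  Deleting
-- them therefore preserves distances, and all current trees of a run of the
-- algorithm are convex in T.
--
-- First inequality.  Given configurations u and v, choose the pairs of step A2
-- by looking at u.  Let i, j be at distance d = diam.  If the token of i is
-- nearer than d to i, bringing it home and then the token of j costs at most
-- (d − 1) + d swaps.  Otherwise replace j by the position of that token; then
-- the last swap bringing the token of j home also moves the token of i one step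
-- towards i, and again 2d − 1 swaps suffice.
--
-- Second inequality.  Let π be the product of the transpositions of the pairs
-- deleted by a run, and of the last two vertices if two remain.  A transposed
-- pair at distance d contributes 2d − 1 to c(π) − n + Σ dist(i, π(i)).
module Submission where

open import Defs
open import Data.Integer using (ℤ; +_) renaming (_≤_ to _≤ᶻ_)
open import Data.Nat using (ℕ; _≤_)
open import Data.Product using (_×_)

open import Data.Empty using (⊥-elim)
open import Data.Fin using (Fin; zero; suc; inject₁; fromℕ; punchIn; punchOut)
open import Data.Fin.Permutation
  using (Permutation′; permutation; transpose; inverseʳ; _⟨$⟩ʳ_; _⟨$⟩ˡ_; _∘ₚ_)
open import Data.Fin.Permutation.Components as PC using ()
open import Data.Fin.Properties as Fin using (_≟_; any?)
open import Data.Fin.Subset using (Subset; _∈_; _∉_; _-_; ∣_∣; ⊤; ⊥; Nonempty; inside; outside)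
open import Data.Fin.Subset.Properties
  using (_∈?_; ∈⊤; ∉⊥; ∣⊤∣≡n; ∣⊥∣≡0; Empty-unique; nonempty?; p─q⊆p;
         p⊆q⇒∣p∣≤∣q∣; ∣p∣≤∣x∷p∣; drop-there; x∈p∧x≢y⇒x∈p-y; x∈p⇒∣p-x∣<∣p∣)
import Data.Integer as ℤ
import Data.Integer.Properties as ℤₚ
open import Data.List using (List; filter; cartesianProduct; allFin; tabulate)
open import Data.List.Extrema.Nat using (argmax; f[xs]≤f[argmax]; argmax-all)
open import Data.List.Membership.Propositional.Properties
  using (∈-filter⁺; ∈-cartesianProduct⁺; ∈-allFin)
open import Data.List.Relation.Unary.All using (lookup)
open import Data.List.Relation.Unary.All.Properties using (all-filter)
open import Data.Nat using (zero; suc; _+_; _*_; _∸_; _<_; z≤n; s≤s; _≤?_; _<?_)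
open import Data.Nat.GeneralisedArithmetic using (iterate)
open import Data.Nat.ListAction using (sum)
open import Data.Nat.Properties hiding (_≟_)
open import Data.Product using (∃; ∃₂; _,_; proj₁; proj₂)
open import Data.Sum using (_⊎_; inj₁; inj₂)
open import Data.Vec using (_∷_; here; there)
open import Data.Vec.Functional using (updateAt)
open import Data.Vec.Functional.Properties using (updateAt-updates; updateAt-minimal)
open import Function using (_∘_; const; _⇔_; mk⇔; Injective; Surjective)
open import Function.Bundles using (Injection)
open import Function.Properties.Inverse using (↔⇒↣)
open import Level using (0ℓ)
open import Relation.Binary using (Setoid)
open import Relation.Binary.PropositionalEquality
  using (_≡_; _≢_; refl; sym; trans; cong; subst)
open import Relation.Nullary using (Dec; yes; no; contradiction)
open import Relation.Nullary.Decidable using (_×-dec_; dec-true; dec-false; map′)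
open import Relation.Unary using (Pred; Decidable)

private variable
  n : ℕ

-- Least witnesses and an arithmetic bound.

least : {P : Pred ℕ 0ℓ} → Decidable P → ∀ {k} → P k → ∃ λ m → P m × (∀ {j} → P j → m ≤ j)
least P? {k} pk with P? 0
... | yes p0 = 0 , p0 , λ _ → z≤n
least P? {zero}  pk | no ¬p0 = contradiction pk ¬p0
least P? {suc k} pk | no ¬p0 with least (P? ∘ suc) pk
... | m , pm , min = suc m , pm , λ
  { {zero} p0 → contradiction p0 ¬p0 ; {suc j} pj → s≤s (min pj) }

-- The cost of one pass of step A3: one token travels less than the diameter `d`, the other at most
-- `d`.
<⇒+≤2*∸1 : ∀ {k l d} → k < d → l ≤ d → k + l ≤ 2 * d ∸ 1
<⇒+≤2*∸1 {k} {l} {d} k<d l≤d = subst (λ e → k + l ≤ d + e ∸ 1) (sym (+-identityʳ d))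
  (<⇒≤pred (+-mono-≤ k<d l≤d))

-- Sizes of subsets.

i∉p-i : (p : Subset n) (i : Fin n) → i ∉ p - i
i∉p-i (inside  ∷ p) zero ()
i∉p-i (outside ∷ p) zero ()
i∉p-i (s ∷ p) (suc i) (there m) = i∉p-i p i m

p-x⊆p : (p : Subset n) (x : Fin n) {y : Fin n} → y ∈ p - x → y ∈ p
p-x⊆p p x = p─q⊆p p _

y∈p-x⇒y≢x : {p : Subset n} {x y : Fin n} → y ∈ p - x → y ≢ x
y∈p-x⇒y≢x {p = p} {x} m refl = i∉p-i p x m

y∉p-x⇒y≡x⊎y∉p : {p : Subset n} {x y : Fin n} → y ∉ p - x → y ≡ x ⊎ y ∉ p
y∉p-x⇒y≡x⊎y∉p {x = x} {y} y∉ with y ≟ x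
... | yes y≡x = inj₁ y≡x
... | no  y≢x = inj₂ λ y∈p → y∉ (x∈p∧x≢y⇒x∈p-y y∈p y≢x)

-- Stated for an arbitrary `q` instead of `p - x`, so that the recursion can take the tails of both
-- vectors.
∣p∣≤1+∣q∣ : (p q : Subset n) (x : Fin n) → (∀ {y} → y ∈ p → y ≢ x → y ∈ q) → ∣ p ∣ ≤ suc ∣ q ∣
∣p∣≤1+∣q∣ (s ∷ p) (t ∷ q) zero p⊆q = ≤-trans (head≤ s) (s≤s (≤-trans tail≤ (∣p∣≤∣x∷p∣ t q)))
  where
  head≤ : ∀ s → ∣ s ∷ p ∣ ≤ suc ∣ p ∣
  head≤ inside  = ≤-refl
  head≤ outside = n≤1+n _

  tail≤ : ∣ p ∣ ≤ ∣ q ∣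
  tail≤ = p⊆q⇒∣p∣≤∣q∣ λ y∈p → drop-there (p⊆q (there y∈p) λ ())
∣p∣≤1+∣q∣ (s ∷ p) (t ∷ q) (suc x) p⊆q = cons≤ s t (λ { refl → head-inside (p⊆q here λ ()) })
  (∣p∣≤1+∣q∣ p q x λ y∈p y≢x → drop-there (p⊆q (there y∈p) (y≢x ∘ Fin.suc-injective)))
  where
  head-inside : ∀ {t} → zero ∈ t ∷ q → t ≡ inside
  head-inside here = refl

  cons≤ : ∀ s t → (s ≡ inside → t ≡ inside) → ∣ p ∣ ≤ suc ∣ q ∣ → ∣ s ∷ p ∣ ≤ suc ∣ t ∷ q ∣
  cons≤ inside  t s⇒t le rewrite s⇒t refl = s≤s le
  cons≤ outside t _   le = ≤-trans le (s≤s (∣p∣≤∣x∷p∣ t q))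

∣p∣≤1+∣p-x∣ : (p : Subset n) (x : Fin n) → ∣ p ∣ ≤ suc ∣ p - x ∣
∣p∣≤1+∣p-x∣ p x = ∣p∣≤1+∣q∣ p (p - x) x x∈p∧x≢y⇒x∈p-y

x∈p⇒0<∣p∣ : {p : Subset n} {x : Fin n} → x ∈ p → 0 < ∣ p ∣
x∈p⇒0<∣p∣ x∈p = ≤-trans (s≤s z≤n) (x∈p⇒∣p-x∣<∣p∣ x∈p)

0<∣p∣⇒nonempty : (p : Subset n) → 0 < ∣ p ∣ → Nonempty p
0<∣p∣⇒nonempty {n} p 0<p with nonempty? p
... | yes ne = ne
... | no  em = contradiction (subst (0 <_) (trans (cong ∣_∣ (Empty-unique em)) (∣⊥∣≡0 n)) 0<p) λ ()

1<∣p∣⇒two : (p : Subset n) → 1 < ∣ p ∣ → ∃₂ λ x y → x ∈ p × y ∈ p × x ≢ y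
1<∣p∣⇒two p 1<p with 0<∣p∣⇒nonempty p (≤-trans (n≤1+n 1) 1<p)
... | x , x∈p with 0<∣p∣⇒nonempty (p - x) (≤-pred (≤-trans 1<p (∣p∣≤1+∣p-x∣ p x)))
... | y , y∈p-x = x , y , x∈p , p-x⊆p p x y∈p-x , λ x≡y → y∈p-x⇒y≢x y∈p-x (sym x≡y)

-- Transpositions and permutations.

transpose-fst : (i j : Fin n) → PC.transpose i j i ≡ j
transpose-fst i j rewrite dec-true (i ≟ i) refl = refl

transpose-snd : (i j : Fin n) → PC.transpose i j j ≡ i
transpose-snd i j with j ≟ i
... | yes j≡i = j≡i
... | no  _ rewrite dec-true (j ≟ j) refl = refl

transpose-other : {i j x : Fin n} → x ≢ i → x ≢ j → PC.transpose i j x ≡ x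
transpose-other {i = i} {j} {x} x≢i x≢j
  rewrite dec-false (x ≟ i) x≢i | dec-false (x ≟ j) x≢j = refl

⟨$⟩ʳ-injective : (π : Permutation′ n) {i j : Fin n} → π ⟨$⟩ʳ i ≡ π ⟨$⟩ʳ j → i ≡ j
⟨$⟩ʳ-injective π = Injection.injective (↔⇒↣ π)

-- Gluing two labels.

-- The quotient map that drops the label `p` in favour of `q`; it renumbers cycles when two of them
-- are joined.
merge : {p q : Fin (suc n)} → p ≢ q → Fin (suc n) → Fin n
merge {p = p} p≢q x with p ≟ x
... | yes _  = punchOut p≢q
... | no p≢x = punchOut p≢x

merge-identifies : {p q : Fin (suc n)} (p≢q : p ≢ q) → merge p≢q p ≡ merge p≢q q
merge-identifies {p = p} {q} p≢q with p ≟ p | p ≟ q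
... | no p≢p | _       = contradiction refl p≢p
... | yes _  | yes p≡q = contradiction p≡q p≢q
... | yes _  | no p≢q′ = Fin.punchOut-cong p refl

merge-reflect : {p q : Fin (suc n)} (p≢q : p ≢ q) {x y : Fin (suc n)} → merge p≢q x ≡ merge p≢q y →
                x ≡ y ⊎ (x ≡ p × y ≡ q) ⊎ (x ≡ q × y ≡ p)
merge-reflect {p = p} p≢q {x} {y} e with p ≟ x | p ≟ y
... | yes refl | yes refl = inj₁ refl
... | yes refl | no p≢y   = inj₂ (inj₁ (refl , sym (Fin.punchOut-injective p≢q p≢y e)))
... | no p≢x   | yes refl = inj₂ (inj₂ (Fin.punchOut-injective p≢x p≢q e , refl))
... | no p≢x   | no p≢y   = inj₁ (Fin.punchOut-injective p≢x p≢y e)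

merge-onto : {p q : Fin (suc n)} (p≢q : p ≢ q) (y : Fin n) → ∃ λ x → merge p≢q x ≡ y
merge-onto {p = p} p≢q y = punchIn p y , merge-punchIn
  where
  merge-punchIn : merge p≢q (punchIn p y) ≡ y
  merge-punchIn with p ≟ punchIn p y
  ... | yes e  = contradiction (sym e) (Fin.punchInᵢ≢i p y)
  ... | no p≢x = trans (Fin.punchOut-cong p refl) (Fin.punchOut-punchIn p)

-- Comparison of sums.

sum-mono : {g h : Fin n → ℕ} → (∀ x → h x ≤ g x) → sum (tabulate h) ≤ sum (tabulate g)
sum-mono {zero}  h≤g = z≤n
sum-mono {suc n} h≤g = +-mono-≤ (h≤g zero) (sum-mono (h≤g ∘ suc))

sum-raise : {g h : Fin n → ℕ} (i : Fin n) → h i ≡ 0 → (∀ {x} → x ≢ i → h x ≤ g x) →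
            sum (tabulate h) + g i ≤ sum (tabulate g)
sum-raise {g = g} {h} zero h0≡0 h≤g rewrite h0≡0 =
  ≤-trans (≤-reflexive (+-comm _ (g zero))) (+-monoʳ-≤ (g zero) (sum-mono {h = h ∘ suc} λ x → h≤g {suc x} λ ()))
sum-raise {g = g} {h} (suc i) hi≡0 h≤g =
  ≤-trans (≤-reflexive (+-assoc (h zero) _ _))
    (+-mono-≤ (h≤g λ ()) (sum-raise {h = h ∘ suc} i hi≡0 λ x≢i → h≤g (x≢i ∘ Fin.suc-injective)))

-- Concatenation of walks.

module _ {V : Setoid 0ℓ 0ℓ} (G : Graph V) where
  open Setoid V using (_≈_) renaming (trans to ≈-trans; sym to ≈-sym)
  open Graph G

  Walk-respˡ : ∀ {k u v w} → u ≈ v → Walk G k v w → Walk G k u w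
  Walk-respˡ u≈v (nil v≈w)  = nil (≈-trans u≈v v≈w)
  Walk-respˡ u≈v (cons a r) = cons (proj₂ resp (≈-sym u≈v) a) r

  _++ʷ_ : ∀ {k l u v w} → Walk G k u v → Walk G l v w → Walk G (k + l) u w
  nil u≈v  ++ʷ q = Walk-respˡ u≈v q
  cons a p ++ʷ q = cons a (p ++ʷ q)

-- Paths inside a vertex set of the tree.

module _ {n : ℕ} (T : Tree n) where
  open Tree T
  open Graph graph

  -- Endpoints are bare vertices and membership in `U` sits in the constructors, so that paths in
  -- different subsets have comparable endpoints.
  data Path (U : Subset n) : ℕ → Fin n → Fin n → Set where
    nil  : ∀ {u} → u ∈ U → Path U 0 u u
    cons : ∀ {k u w v} → u ∈ U → Adj u w → Path U k w v → Path U (suc k) u v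

  source∈ : ∀ {U k u v} → Path U k u v → u ∈ U
  source∈ (nil u∈U)      = u∈U
  source∈ (cons u∈U _ _) = u∈U

  _++_ : ∀ {U k l u v w} → Path U k u v → Path U l v w → Path U (k + l) u w
  nil _      ++ q = q
  cons u a p ++ q = cons u a (p ++ q)

  snoc : ∀ {U k u v w} → Path U k u v → Adj v w → w ∈ U → Path U (suc k) u w
  snoc (nil u∈U)      b w∈U = cons u∈U b (nil w∈U)
  snoc (cons u∈U a p) b w∈U = cons u∈U a (snoc p b w∈U)

  reverse : ∀ {U k u v} → Path U k u v → Path U k v u
  reverse (nil u∈U)      = nil u∈U
  reverse (cons u∈U a p) = snoc (reverse p) (symm a) u∈U

  ⊆⊤ : ∀ {U k u v} → Path U k u v → Path ⊤ k u v
  ⊆⊤ (nil _)      = nil ∈⊤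
  ⊆⊤ (cons _ a p) = cons ∈⊤ a (⊆⊤ p)

  path? : ∀ U k u v → Dec (Path U k u v)
  path? U zero u v = map′ (λ { (u∈U , refl) → nil u∈U }) (λ { (nil u∈U) → u∈U , refl })
                          (u ∈? U ×-dec u ≟ v)
  path? U (suc k) u v = map′ (λ { (u∈U , w , a , p) → cons u∈U a p })
                             (λ { (cons u∈U a p) → u∈U , _ , a , p })
                             (u ∈? U ×-dec any? λ w → adj? u w ×-dec path? U k w v)

  toWalk : ∀ {U k u v} → Path U k u v → (u∈U : u ∈ U) (v∈U : v ∈ U) →
           Walk (induced graph U) k (u , u∈U) (v , v∈U)
  toWalk (nil _)      u∈U v∈U = nil refl
  toWalk (cons _ a p) u∈U v∈U = cons {w = _ , source∈ p} a (toWalk p (source∈ p) v∈U)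

  fromWalk : ∀ {U k x y} → Walk (induced graph U) k x y → Path U k (proj₁ x) (proj₁ y)
  fromWalk {x = _ , x∈U} (nil refl)  = nil x∈U
  fromWalk {x = _ , x∈U} (cons a p)  = cons x∈U a (fromWalk p)

  toWalk⊤ : ∀ {U k u v} → Path U k u v → Walk graph k u v
  toWalk⊤ (nil _)      = nil refl
  toWalk⊤ (cons _ a p) = cons a (toWalk⊤ p)

  fromWalk⊤ : ∀ {k u v} → Walk graph k u v → Path ⊤ k u v
  fromWalk⊤ (nil refl) = nil ∈⊤
  fromWalk⊤ (cons a p) = cons ∈⊤ a (fromWalk⊤ p)

  -- Distances and convex sets.

  private
    geodesic : ∀ x y → ∃ λ m → Path ⊤ m x y × (∀ {k} → Path ⊤ k x y → m ≤ k)
    geodesic x y = least (λ k → path? ⊤ k x y) (fromWalk⊤ (proj₂ (connected x y)))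

  opaque
    δ : Fin n → Fin n → ℕ
    δ x y = proj₁ (geodesic x y)

    δ-min : ∀ {U k x y} → Path U k x y → δ x y ≤ k
    δ-min p = proj₂ (proj₂ (geodesic _ _)) (⊆⊤ p)

    δ-path : ∀ x y → Path ⊤ (δ x y) x y
    δ-path x y = proj₁ (proj₂ (geodesic x y))

  -- A geodesic of the whole tree stays in `U`, so the subgraph induced by `U` has the distances `δ`
  -- of the tree.
  Convex : Subset n → Set
  Convex U = ∀ {x y} → x ∈ U → y ∈ U → Path U (δ x y) x y

  ⊤-convex : Convex ⊤
  ⊤-convex _ _ = δ-path _ _

  δ-isDist : ∀ x y → IsDist graph x y (δ x y)
  δ-isDist x y = toWalk⊤ (δ-path x y) , λ w → δ-min (fromWalk⊤ w)

  δ-sym : ∀ x y → δ x y ≡ δ y x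
  δ-sym x y = ≤-antisym (half x y) (half y x)
    where
    half : ∀ x y → δ x y ≤ δ y x
    half x y = δ-min (reverse (δ-path y x))

  δ-refl : ∀ x → δ x x ≡ 0
  δ-refl x = n≤0⇒n≡0 (δ-min (nil {⊤} ∈⊤))

  0<δ : ∀ {x y} → x ≢ y → 0 < δ x y
  0<δ {x} {y} x≢y with δ x y | δ-path x y
  ... | zero  | nil _ = contradiction refl x≢y
  ... | suc _ | _     = s≤s z≤n

  -- Shortest paths and cycles.

  vertex : ∀ {U k u v} → Path U k u v → Fin (suc k) → Fin n
  vertex {u = u} _      zero    = u
  vertex (cons _ _ p) (suc t) = vertex p t

  vertex∈ : ∀ {U k u v} (p : Path U k u v) t → vertex p t ∈ U
  vertex∈ p            zero    = source∈ p
  vertex∈ (cons _ _ p) (suc t) = vertex∈ p t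

  vertex-last : ∀ {U k u v} (p : Path U k u v) → vertex p (fromℕ k) ≡ v
  vertex-last (nil _)      = refl
  vertex-last (cons _ _ p) = vertex-last p

  vertex-adj : ∀ {U k u v} (p : Path U k u v) (t : Fin k) →
               Adj (vertex p (inject₁ t)) (vertex p (suc t))
  vertex-adj (cons _ a p) zero    = a
  vertex-adj (cons _ a p) (suc t) = vertex-adj p t

  suffix : ∀ {U k u v} (p : Path U k u v) t → ∃ λ l → l ≤ k × Path U l (vertex p t) v
  suffix p zero = _ , ≤-refl , p
  suffix (cons _ _ p) (suc t) with suffix p t
  ... | l , l≤k , q = l , ≤-trans l≤k (n≤1+n _) , q

  Shortest : ∀ {U k u v} → Path U k u v → Set
  Shortest {U} {k} {u} {v} p = ∀ {l} → Path U l u v → k ≤ l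

  -- A repeated vertex allows a shortcut: the suffix from its second occurrence replaces the longer
  -- one from its first.
  vertex-injective : ∀ {U k u v} (p : Path U k u v) → Shortest p → Injective _≡_ _≡_ (vertex p)
  vertex-injective p short {zero} {zero} _ = refl
  vertex-injective (cons _ _ p) short {zero} {suc t} e with suffix p t
  ... | l , l≤k , q = contradiction (short (subst (λ x → Path _ l x _) (sym e) q)) (<⇒≱ (s≤s l≤k))
  vertex-injective (cons _ _ p) short {suc s} {zero} e with suffix p s
  ... | l , l≤k , q = contradiction (short (subst (λ x → Path _ l x _) e q)) (<⇒≱ (s≤s l≤k))
  vertex-injective (cons u∈ a p) short {suc s} {suc t} e =
    cong suc (vertex-injective p (λ q → ≤-pred (short (cons u∈ a q))) e)

  -- Otherwise a shortest path from `a` to `b` avoiding `j`, closed up through `j`, is a cycle.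
  no-detour : ∀ {U k j a b} → Adj j a → Adj j b → Path (U - j) k a b → a ≡ b
  no-detour {U} {j = j} {a} {b} ja jb p with least (λ k → path? (U - j) k a b) p
  ... | zero  , nil _ , _     = refl
  -- A path of length `suc k` has `2 + k` vertices; `j` is the remaining one of the cycle.
  ... | suc k , q     , short = ⊥-elim (acyclic (k , c , c-injective , c-adj , c-close))
    where
    c : Fin (3 + k) → Fin n
    c zero    = j
    c (suc t) = vertex q t

    c-injective : Injective _≡_ _≡_ c
    c-injective {zero}  {zero}  _ = refl
    c-injective {zero}  {suc t} e = contradiction (sym e) (y∈p-x⇒y≢x (vertex∈ q t))
    c-injective {suc s} {zero}  e = contradiction e (y∈p-x⇒y≢x (vertex∈ q s))
    c-injective {suc s} {suc t} e = cong suc (vertex-injective q short e)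

    c-adj : ∀ (t : Fin (2 + k)) → Adj (c (inject₁ t)) (c (suc t))
    c-adj zero    = ja
    c-adj (suc t) = vertex-adj q t

    c-close : Adj (c (fromℕ (2 + k))) j
    c-close = subst (λ x → Adj x j) (sym (vertex-last q)) (symm jb)

  -- Deleting leaves.

  Leaf : Subset n → Fin n → Set
  Leaf U j = ∀ {a b} → a ∈ U → b ∈ U → Adj j a → Adj j b → a ≡ b

  bypass-leaf : ∀ {U j k x y} → Leaf U j → Path U k x y → x ≢ j → y ≢ j →
                ∃ λ l → l ≤ k × Path (U - j) l x y
  bypass-leaf leaf (nil x∈U) x≢j _ = 0 , z≤n , nil (x∈p∧x≢y⇒x∈p-y x∈U x≢j)
  bypass-leaf {j = j} leaf (cons {w = w} x∈U a p) x≢j y≢j with w ≟ j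
  ... | no w≢j with bypass-leaf leaf p w≢j y≢j
  ...   | l , l≤k , q = suc l , s≤s l≤k , cons (x∈p∧x≢y⇒x∈p-y x∈U x≢j) a q
  bypass-leaf leaf (cons x∈U a (nil _)) x≢j y≢j | yes refl = contradiction refl y≢j
  bypass-leaf leaf (cons x∈U a (cons _ b p)) x≢j y≢j | yes refl
    with refl ← leaf x∈U (source∈ p) (symm a) b
    with bypass-leaf leaf p x≢j y≢j
  ... | l , l≤k , q = l , ≤-trans l≤k (≤-trans (n≤1+n _) (n≤1+n _)) , q

  delete-leaf : ∀ {U j} → Convex U → Leaf U j → Convex (U - j)
  delete-leaf {U} {j} conv leaf x∈ y∈
    with bypass-leaf leaf (conv (p-x⊆p U j x∈) (p-x⊆p U j y∈)) (y∈p-x⇒y≢x x∈) (y∈p-x⇒y≢x y∈)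
  ... | l , l≤δ , q = subst (λ k → Path (U - j) k _ _) (≤-antisym l≤δ (δ-min q)) q

  -- Diametral pairs.

  -- The pairs allowed in step A2, measured by distances in the whole tree; for convex `U` these are
  -- the induced distances.
  record Diametral (U : Subset n) (i j : Fin n) : Set where
    field
      i∈U     : i ∈ U
      j∈U     : j ∈ U
      maximal : ∀ {x y} → x ∈ U → y ∈ U → δ x y ≤ δ i j

  open Diametral

  Diametral-sym : ∀ {U i j} → Diametral U i j → Diametral U j i
  Diametral-sym {i = i} {j} D = record
    { i∈U = j∈U D ; j∈U = i∈U D
    ; maximal = λ x∈ y∈ → subst (_ ≤_) (δ-sym i j) (maximal D x∈ y∈) }

  diametral : ∀ U → Nonempty U → ∃₂ (Diametral U)
  diametral U (a , a∈U) = proj₁ best , proj₂ best , record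
    { i∈U = proj₁ best∈ ; j∈U = proj₂ best∈
    ; maximal = λ {x} {y} x∈ y∈ → lookup (f[xs]≤f[argmax] {f = f} (a , a) pairs)
        (∈-filter⁺ inU? (∈-cartesianProduct⁺ (∈-allFin x) (∈-allFin y)) (x∈ , y∈)) }
    where
    f : Fin n × Fin n → ℕ
    f (x , y) = δ x y

    InU : Pred (Fin n × Fin n) 0ℓ
    InU (x , y) = x ∈ U × y ∈ U

    inU? : Decidable InU
    inU? (x , y) = x ∈? U ×-dec y ∈? U

    pairs : List (Fin n × Fin n)
    pairs = filter inU? (cartesianProduct (allFin n) (allFin n))

    -- The default `(a , a)` is itself a pair in `U`, so the maximizer lies in `U` in every case.
    best : Fin n × Fin n
    best = argmax f (a , a) pairs

    best∈ : InU best
    best∈ = argmax-all f (a∈U , a∈U) (all-filter inU? (cartesianProduct (allFin n) (allFin n)))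

  diametral-≢ : ∀ {U i j} → 1 < ∣ U ∣ → Diametral U i j → i ≢ j
  diametral-≢ {U} {i} 1<U D refl with 1<∣p∣⇒two U 1<U
  ... | x , y , x∈ , y∈ , x≢y =
    contradiction (0<δ x≢y) (≤⇒≯ (subst (δ x y ≤_) (δ-refl i) (maximal D x∈ y∈)))

  -- A path to i no longer than the distance from j to i cannot pass through j later on.
  avoid : ∀ {U k a i j} → Path U k a i → a ≢ j → k ≤ δ j i → Path (U - j) k a i
  avoid (nil a∈U) a≢j _ = nil (x∈p∧x≢y⇒x∈p-y a∈U a≢j)
  avoid {j = j} (cons {w = w} a∈U a p) a≢j k≤ with w ≟ j
  ... | yes refl = contradiction (δ-min p) (<⇒≱ k≤)
  ... | no  w≢j  = cons (x∈p∧x≢y⇒x∈p-y a∈U a≢j) a (avoid p w≢j (≤-trans (n≤1+n _) k≤))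

  -- By maximality a neighbour of `j` is no farther from `i` than `j` is, so its geodesic to `i`
  -- avoids `j`. Two such geodesics join the neighbours.
  diametral-leaf : ∀ {U i j} → Convex U → Diametral U i j → Leaf U j
  diametral-leaf {U} {i} {j} conv D a∈ b∈ ja jb = no-detour ja jb (toI a∈ ja ++ reverse (toI b∈ jb))
    where
    toI : ∀ {a} → a ∈ U → Adj j a → Path (U - j) (δ a i) a i
    toI a∈ ja = avoid (conv a∈ (i∈U D)) (λ a≡j → irrefl (sym a≡j) ja)
                      (subst (δ _ i ≤_) (δ-sym i j) (maximal D a∈ (i∈U D)))

  delete-end : ∀ {U i j} → Convex U → Diametral U i j → Convex (U - i)
  delete-end conv D = delete-leaf conv (diametral-leaf conv (Diametral-sym D))

  -- Being a leaf passes to smaller vertex sets, so `j` is still a leaf once `i` is gone.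
  delete-ends : ∀ {U i j} → Convex U → Diametral U i j → Convex (U - i - j)
  delete-ends {U} {i} conv D = delete-leaf (delete-end conv D)
    (λ a∈ b∈ → diametral-leaf conv D (p-x⊆p U i a∈) (p-x⊆p U i b∈))

  first-step : ∀ {U j x} → Convex U → j ∈ U → x ∈ U → x ≢ j →
               ∃ λ w → w ∈ U × Adj j w × δ w x < δ j x
  first-step {j = j} {x} conv j∈ x∈ x≢j with δ j x | conv j∈ x∈
  ... | zero  | nil _      = contradiction refl x≢j
  ... | suc k | cons _ a p = _ , source∈ p , a , s≤s (δ-min p)

  -- All geodesics that leave a leaf start with the same edge.
  neighbour : ∀ {U i j} → Convex U → Leaf U j → j ∈ U → i ∈ U → i ≢ j →
              ∃ λ j′ → j′ ∈ U × Adj j j′ × (∀ {x} → x ∈ U → x ≢ j → δ j′ x < δ j x)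
  neighbour {U} {i} {j} conv leaf j∈ i∈ i≢j with first-step conv j∈ i∈ i≢j
  ... | j′ , j′∈ , a , _ = j′ , j′∈ , a , closer
    where
    closer : ∀ {x} → x ∈ U → x ≢ j → δ j′ x < δ j x
    closer x∈ x≢j with first-step conv j∈ x∈ x≢j
    ... | w , w∈ , b , w< with refl ← leaf j′∈ w∈ a b = w<

  -- Distance and diameter of convex induced subgraphs.

  induced-isDist : ∀ {U x y} → Convex U → (x∈ : x ∈ U) (y∈ : y ∈ U) →
                   IsDist (induced graph U) (x , x∈) (y , y∈) (δ x y)
  induced-isDist conv x∈ y∈ = toWalk (conv x∈ y∈) x∈ y∈ , λ w → δ-min (fromWalk w)

  induced-dist≡δ : ∀ {U x y d} → Convex U → (x∈ : x ∈ U) (y∈ : y ∈ U) →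
                   IsDist (induced graph U) (x , x∈) (y , y∈) d → d ≡ δ x y
  induced-dist≡δ conv x∈ y∈ (w , min) =
    ≤-antisym (min (toWalk (conv x∈ y∈) x∈ y∈)) (δ-min (fromWalk w))

  induced-isDiam : ∀ {U i j} → Convex U → Diametral U i j → IsDiam (induced graph U) (δ i j)
  induced-isDiam conv D =
    (λ (x , x∈) (y , y∈) → δ x y , induced-isDist conv x∈ y∈ , maximal D x∈ y∈) ,
    _ , _ , induced-isDist conv (i∈U D) (j∈U D)

  isDiam⇒diametral : ∀ {U i j} → Convex U → i ∈ U → j ∈ U →
                     IsDiam (induced graph U) (δ i j) → Diametral U i j
  isDiam⇒diametral {i = i} {j} conv i∈ j∈ (all , _) = record
    { i∈U = i∈ ; j∈U = j∈ ; maximal = λ {x} {y} x∈ y∈ → bound x∈ y∈ (all (x , x∈) (y , y∈)) }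
    where
    bound : ∀ {x y} (x∈ : x ∈ _) (y∈ : y ∈ _) →
            (∃ λ d → IsDist (induced graph _) (x , x∈) (y , y∈) d × d ≤ δ i j) → δ x y ≤ δ i j
    bound x∈ y∈ (d , dist , d≤) = subst (_≤ δ i j) (induced-dist≡δ conv x∈ y∈ dist) d≤


  -- Configurations of tokens and swaps.

  -- A permutation `u` puts the token `u ⟨$⟩ʳ x` on vertex `x`, and an edge of `Γ` swaps two
  -- adjacent tokens. Off `U` the target `v` is already reached.
  AgreeOff : Subset n → Permutation′ n → Permutation′ n → Set
  AgreeOff U u v = ∀ {x} → x ∉ U → u ⟨$⟩ʳ x ≡ v ⟨$⟩ʳ x

  Γ : Graph (Sym n)
  Γ = cayley graph

  -- Swaps along the successive edges push the token of `p` to `i`; they touch only vertices of `U`.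
  carry : ∀ {U k p i} → Path U k p i → ∀ u →
          ∃ λ u′ → Walk Γ k u u′ × u′ ⟨$⟩ʳ i ≡ u ⟨$⟩ʳ p × AgreeOff U u′ u
  carry (nil _) u = u , nil (λ _ → refl) , refl , λ _ → refl
  carry {U} (cons {u = p} {w} p∈U a r) u with carry r (transpose p w ∘ₚ u)
  ... | u′ , walk , at-i , off =
    u′ , cons (p , w , a , λ _ → refl) walk ,
    trans at-i (cong (u ⟨$⟩ʳ_) (transpose-snd p w)) ,
    λ x∉U → trans (off x∉U) (cong (u ⟨$⟩ʳ_) (transpose-other
      (λ { refl → x∉U p∈U }) (λ { refl → x∉U (source∈ r) })))

  -- In the configuration u, the token that v puts at i stands at position u v i.
  position : Permutation′ n → Permutation′ n → Fin n → Fin n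
  position u v i = u ⟨$⟩ˡ (v ⟨$⟩ʳ i)

  at-position : ∀ u v i → u ⟨$⟩ʳ position u v i ≡ v ⟨$⟩ʳ i
  at-position u v i = inverseʳ u

  -- At a position `p` outside `U` both configurations would carry the token that `v` puts at `i`,
  -- forcing `p` to be `i`.
  position∈ : ∀ {U u v i} → AgreeOff U u v → i ∈ U → position u v i ∈ U
  position∈ {U} {u} {v} {i} off i∈U with position u v i ∈? U
  ... | yes p∈U = p∈U
  ... | no  p∉U = subst (_∈ U)
    (sym (⟨$⟩ʳ-injective v (trans (sym (off p∉U)) (at-position u v i)))) i∈U

  deliver : ∀ {U k p i u v} → AgreeOff U u v → u ⟨$⟩ʳ p ≡ v ⟨$⟩ʳ i → Path U k p i →
            ∃ λ u′ → Walk Γ k u u′ × AgreeOff (U - i) u′ v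
  deliver {U} {i = i} {u} {v} off at-p r with carry r u
  ... | u′ , walk , at-i , off′ = u′ , walk , λ x∉ → settled (y∉p-x⇒y≡x⊎y∉p x∉)
    where
    settled : ∀ {x} → x ≡ i ⊎ x ∉ U → u′ ⟨$⟩ʳ x ≡ v ⟨$⟩ʳ x
    settled (inj₁ refl) = trans at-i at-p
    settled (inj₂ x∉U)  = trans (off′ x∉U) (off x∉U)

  -- Settling a diametral pair.

  -- One pass of the algorithm on tokens: the swaps spent are at most what step A3 adds to the
  -- value.
  Cleared : Subset n → Permutation′ n → Permutation′ n → Set
  Cleared U u v = ∃₂ λ i j → Diametral U i j × ∃₂ λ u′ k →
    Walk Γ k u u′ × AgreeOff (U - i - j) u′ v × k ≤ 2 * δ i j ∸ 1

  -- The token of `i` goes first; that of `j` then moves inside `U - i`, which is still convex, and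
  -- leaves `i` settled.
  clear-near : ∀ {U i j u v} → Convex U → Diametral U i j → i ≢ j → AgreeOff U u v →
               δ (position u v i) i < δ i j → Cleared U u v
  clear-near {U} {i} {j} {u} {v} conv D i≢j off near
    with deliver {u = u} {v} off (at-position u v i) (conv (position∈ {u = u} {v} off (i∈U D)) (i∈U D))
  ... | u₁ , walk₁ , off₁ with x∈p∧x≢y⇒x∈p-y (j∈U D) (i≢j ∘ sym)
  ... | j∈ with position∈ {u = u₁} {v} off₁ j∈
  ... | q∈ with deliver {u = u₁} {v} off₁ (at-position u₁ v j) (delete-end conv D q∈ j∈)
  ... | u₂ , walk₂ , off₂ =
    i , j , D , u₂ , _ , _++ʷ_ Γ walk₁ walk₂ , off₂ ,
    <⇒+≤2*∸1 near (maximal D (p-x⊆p U i q∈) (j∈U D))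

  -- With `q` the position of the token of `j`, and `j′` the neighbour of `j`, the cost is
  -- `δ q j′ + 1 + δ j′ i`. Here `j′` is nearer than `j` both to `q` and to `i`.
  clear-facing : ∀ {U i j u v} → Convex U → Diametral U i j → i ≢ j → AgreeOff U u v →
                 u ⟨$⟩ʳ j ≡ v ⟨$⟩ʳ i → Cleared U u v
  clear-facing {U} {i} {j} {u} {v} conv D i≢j off at-j
    with diametral-leaf conv D
  ... | leaf with neighbour conv leaf (j∈U D) (i∈U D) i≢j | position∈ {u = u} {v} off (j∈U D)
  ... | j′ , j′∈ , a , closer | q∈
    with x∈p∧x≢y⇒x∈p-y {y = j} q∈ q≢j | x∈p∧x≢y⇒x∈p-y {y = j} j′∈ j′≢j
       | x∈p∧x≢y⇒x∈p-y {y = j} (i∈U D) i≢j | delete-leaf conv leaf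
    where
    q≢j : position u v j ≢ j
    q≢j e = i≢j (⟨$⟩ʳ-injective v (trans (sym at-j)
      (trans (cong (u ⟨$⟩ʳ_) (sym e)) (at-position u v j))))

    j′≢j : j′ ≢ j
    j′≢j e = irrefl (sym e) a
  ... | q∈′ | j′∈′ | i∈′ | conv′ with carry (conv′ q∈′ j′∈′) u
  ... | u₁ , walk₁ , at-j′ , off₁ with deliver {u = transpose j′ j ∘ₚ u₁} {v} off₂ at-j′₂ (conv′ j′∈′ i∈′)
    where
    -- The first stage stays inside `U - j`, so the token of `i` still waits at `j`.
    at-j₁ : u₁ ⟨$⟩ʳ j ≡ v ⟨$⟩ʳ i
    at-j₁ = trans (off₁ (i∉p-i U j)) at-j

    at-j′₂ : (transpose j′ j ∘ₚ u₁) ⟨$⟩ʳ j′ ≡ v ⟨$⟩ʳ i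
    at-j′₂ = trans (cong (u₁ ⟨$⟩ʳ_) (transpose-fst j′ j)) at-j₁

    off₂ : AgreeOff (U - j) (transpose j′ j ∘ₚ u₁) v
    off₂ {x} x∉ with y∉p-x⇒y≡x⊎y∉p x∉
    ... | inj₁ refl = trans (cong (u₁ ⟨$⟩ʳ_) (transpose-snd j′ j)) (trans at-j′ (at-position u v j))
    ... | inj₂ x∉U  = trans (cong (u₁ ⟨$⟩ʳ_) (transpose-other
                        (λ { refl → x∉U j′∈ }) (λ { refl → x∉U (j∈U D) })))
                        (trans (off₁ x∉) (off x∉U))
  ... | u₃ , walk₃ , off₃ =
    -- The pair is listed in reverse because `j` is settled and removed first.
    j , i , Diametral-sym D , u₃ , _ ,
    _++ʷ_ Γ walk₁ (cons (j′ , j , symm a , λ _ → refl) walk₃) , off₃ ,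
    (begin
      δ q j′ + suc (δ j′ i) ≡⟨ +-comm (δ q j′) _ ⟩
      suc (δ j′ i) + δ q j′ ≡⟨ sym (+-suc (δ j′ i) (δ q j′)) ⟩
      δ j′ i + suc (δ q j′) ≤⟨ <⇒+≤2*∸1 (closer (i∈U D) i≢j)
          (subst (_≤ δ j i) (cong suc (δ-sym j′ q))
            (≤-trans (closer q∈ (y∈p-x⇒y≢x q∈′)) (maximal (Diametral-sym D) (j∈U D) q∈))) ⟩
      2 * δ j i ∸ 1 ∎)
    where
    open ≤-Reasoning

    q : Fin n
    q = position u v j

  clear : ∀ {U u v} → Convex U → 1 < ∣ U ∣ → AgreeOff U u v → Cleared U u v
  clear {U} {u} {v} conv 1<U off with diametral U (0<∣p∣⇒nonempty U (≤-trans (n≤1+n 1) 1<U))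
  ... | i , j , D with position∈ {u = u} {v} off (i∈U D)
  ... | p∈ with δ (position u v i) i <? δ i j
  ... | yes near = clear-near {u = u} {v} conv D (diametral-≢ 1<U D) off near
  ... | no  far  = clear-facing {u = u} {v} conv D′ (diametral-≢ 1<U D′) off (at-position u v i)
    where
    -- The token is at least as far from `i` as `j` is, so its position can serve as the other end.
    D′ : Diametral U i (position u v i)
    D′ = record
      { i∈U = i∈U D ; j∈U = p∈
      ; maximal = λ x∈ y∈ → ≤-trans (maximal D x∈ y∈) (subst (δ i j ≤_) (δ-sym _ i) (≮⇒≥ far)) }

  -- The last one or two vertices.

  agree-off-point : ∀ {U u v} → ∣ U ∣ ≤ 1 → AgreeOff U u v → ∀ x → u ⟨$⟩ʳ x ≡ v ⟨$⟩ʳ x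
  agree-off-point {U} {u} {v} U≤1 off x with x ∈? U
  ... | no  x∉U = off x∉U
  ... | yes x∈U with position u v x ≟ x
  ... | yes p≡x = trans (cong (u ⟨$⟩ʳ_) (sym p≡x)) (at-position u v x)
  ... | no  p≢x = contradiction
    (≤-trans (x∈p⇒∣p-x∣<∣p∣ x∈U) U≤1)
    (≤⇒≯ (x∈p⇒0<∣p∣ (x∈p∧x≢y⇒x∈p-y (position∈ {u = u} {v} off x∈U) p≢x)))

  -- Two remaining vertices are adjacent by convexity, so one swap repairs them if needed.
  finish : ∀ {U u v} → Convex U → 0 < ∣ U ∣ → ∣ U ∣ ≤ 2 → AgreeOff U u v →
           ∃ λ k → Walk Γ k u v × k ≤ ∣ U ∣ ∸ 1
  finish {U} {u} {v} conv 0<U U≤2 off with 0<∣p∣⇒nonempty U 0<U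
  ... | a , a∈ with position∈ {u = u} {v} off a∈ | position u v a ≟ a
  ... | p∈ | yes p≡a = 0 , nil (agree-off-point {U - a} {u} {v}
    (≤-pred (≤-trans (x∈p⇒∣p-x∣<∣p∣ a∈) U≤2)) off′) , z≤n
    where
    off′ : AgreeOff (U - a) u v
    off′ x∉ with y∉p-x⇒y≡x⊎y∉p x∉
    ... | inj₁ refl = trans (cong (u ⟨$⟩ʳ_) (sym p≡a)) (at-position u v a)
    ... | inj₂ x∉U  = off x∉U
  ... | p∈ | no p≢a with first-step conv p∈ a∈ (p≢a ∘ sym)
  ... | w , w∈ , pw , _ with w ≟ a
  -- The position of the token, `a` and `w` would be three vertices of `U`.
  ... | no w≢a = contradiction U≤2
    (<⇒≱ (≤-trans (s≤s (≤-trans (s≤s 0<) (x∈p⇒∣p-x∣<∣p∣ a∈′))) (x∈p⇒∣p-x∣<∣p∣ p∈)))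
    where
    a∈′ : a ∈ U - position u v a
    a∈′ = x∈p∧x≢y⇒x∈p-y a∈ (p≢a ∘ sym)

    0< : 0 < ∣ U - position u v a - a ∣
    0< = x∈p⇒0<∣p∣ (x∈p∧x≢y⇒x∈p-y (x∈p∧x≢y⇒x∈p-y w∈ (λ e → irrefl (sym e) pw)) w≢a)
  ... | yes refl with deliver {u = u} {v} off (at-position u v a) (cons p∈ pw (nil a∈))
  ... | u′ , walk , off′ =
    1 , _++ʷ_ Γ walk (nil (agree-off-point {U - a} {u′} {v}
    (≤-pred (≤-trans (x∈p⇒∣p-x∣<∣p∣ a∈) U≤2)) off′)) ,
    ∸-monoˡ-≤ 1 (≤-trans (s≤s (x∈p⇒0<∣p∣ (x∈p∧x≢y⇒x∈p-y p∈ p≢a))) (x∈p⇒∣p-x∣<∣p∣ a∈))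

  -- Sorting along a run, and the diameter of `Γ`.

  -- Run and walk are built together, since the tokens decide which pair is deleted. The bound `m`
  -- on the size of `U` drives the recursion.
  run-bounds-distance : ∀ m {U} → ∣ U ∣ ≤ m → Convex U → 3 ≤ ∣ U ∣ → ∀ β u v → AgreeOff U u v →
                        ∃₂ λ b k → Run T U β b × Walk Γ k u v × β + k ≤ b
  run-bounds-distance zero U≤m conv 3≤U = contradiction (≤-trans 3≤U U≤m) λ ()
  run-bounds-distance (suc m) {U} U≤m conv 3≤U β u v off
    with clear {u = u} {v} conv (≤-trans (n≤1+n 2) 3≤U) off
  ... | i , j , D , u′ , k , walk , off′ , k≤ with delete-ends conv D | 3 ≤? ∣ U - i - j ∣
  ... | conv′ | yes 3≤W
    with run-bounds-distance m W≤m conv′ 3≤W (β + (2 * δ i j ∸ 1)) u′ v off′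
    where
    j∈ : j ∈ U - i
    j∈ = x∈p∧x≢y⇒x∈p-y (j∈U D) (diametral-≢ (≤-trans (n≤1+n 2) 3≤U) D ∘ sym)

    W≤m : ∣ U - i - j ∣ ≤ m
    W≤m = ≤-pred (≤-trans (x∈p⇒∣p-x∣<∣p∣ j∈) (≤-trans (<⇒≤ (x∈p⇒∣p-x∣<∣p∣ (i∈U D))) U≤m))
  ... | b , l , run , walk′ , ≤b =
    b , k + l ,
    loop (i∈U D) (j∈U D) (induced-isDiam conv D) (induced-isDist conv (i∈U D) (j∈U D)) 3≤W run ,
    _++ʷ_ Γ walk walk′ ,
    ≤-trans (≤-reflexive (sym (+-assoc β k l))) (≤-trans (+-monoˡ-≤ l (+-monoʳ-≤ β k≤)) ≤b)
  run-bounds-distance (suc m) {U} U≤m conv 3≤U β u v off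
      | i , j , D , u′ , k , walk , off′ , k≤ | conv′ | no 3≰W
    with finish {u = u′} {v} conv′ 0<W (≤-pred (≰⇒> 3≰W)) off′
    where
    -- Two deletions from at least three vertices leave one.
    0<W : 0 < ∣ U - i - j ∣
    0<W = ≤-pred (≤-pred (≤-trans 3≤U (≤-trans (∣p∣≤1+∣p-x∣ U i) (s≤s (∣p∣≤1+∣p-x∣ (U - i) j)))))
  ... | l , walk′ , l≤ =
    _ , k + l ,
    stop (i∈U D) (j∈U D) (induced-isDiam conv D) (induced-isDist conv (i∈U D) (j∈U D)) (≰⇒> 3≰W) ,
    _++ʷ_ Γ walk walk′ ,
    ≤-trans (≤-reflexive (sym (+-assoc β k l))) (+-mono-≤ (+-monoʳ-≤ β k≤) l≤)

  -- Two configurations at distance `D` yield a run with output at least `D`; agreement off `⊤` is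
  -- vacuous.
  diam≤βmax : 3 ≤ n → ∀ {D β} → IsDiam Γ D → IsMaximum _≤_ (Output T) β → D ≤ β
  diam≤βmax 3≤n (_ , u , v , _ , short) (_ , max)
    with run-bounds-distance n (≤-reflexive (∣⊤∣≡n n)) ⊤-convex (≤-trans 3≤n (≤-reflexive (sym (∣⊤∣≡n n))))
           0 u v (λ x∉ → contradiction ∈⊤ x∉)
  ... | b , k , run , walk , k≤b = ≤-trans (short walk) (≤-trans k≤b (max b run))

  -- Involutions assembled from a run.

  displacement : (Fin n → Fin n) → Fin n → ℕ
  displacement f x = δ x (f x)

  -- A product of disjoint transpositions has cycles of at most two elements, hence the disjunction
  -- in `cyc-reflect`. In `bound` the term `n` is moved across to stay in the naturals.
  record Involution (U : Subset n) (value : ℕ) : Set where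
    field
      f           : Fin n → Fin n
      involutive  : ∀ x → f (f x) ≡ x
      fixes       : ∀ {x} → x ∉ U → f x ≡ x
      cycles      : ℕ
      cyc         : Fin n → Fin cycles
      cyc-onto    : ∀ y → ∃ λ x → cyc x ≡ y
      cyc-f       : ∀ x → cyc (f x) ≡ cyc x
      cyc-reflect : ∀ {x y} → cyc x ≡ cyc y → x ≡ y ⊎ f x ≡ y
      bound       : value + n ≤ cycles + sum (tabulate (displacement f))

  identity : ∀ U → Involution U 0
  identity U = record
    { f = λ x → x ; involutive = λ _ → refl ; fixes = λ _ → refl
    ; cycles = n ; cyc = λ x → x ; cyc-onto = λ y → y , refl
    ; cyc-f = λ _ → refl ; cyc-reflect = inj₁ ; bound = m≤m+n n _ }

  weaken : ∀ {U v w} → w ≤ v → Involution U v → Involution U w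
  weaken w≤v I = record
    { Involution I ; bound = ≤-trans (+-monoˡ-≤ n w≤v) (Involution.bound I) }

  data Place (i j x : Fin n) : Set where
    fst   : x ≡ i → Place i j x
    snd   : x ≡ j → Place i j x
    other : x ≢ i → x ≢ j → Place i j x

  place : ∀ i j x → Place i j x
  place i j x with x ≟ i | x ≟ j
  ... | yes x≡i | _       = fst x≡i
  ... | no _    | yes x≡j = snd x≡j
  ... | no x≢i  | no x≢j  = other x≢i x≢j

  -- Transposing two fixed points joins their cycles, which costs 1, and adds `δ i j` to the sum at
  -- each of them.
  insert : ∀ {W U i j v} → (∀ {x} → x ∈ W → x ∈ U) → i ∈ U → j ∈ U → i ∉ W → j ∉ W → i ≢ j →
           Involution W v → Involution U (v + (2 * δ i j ∸ 1))
  -- The label of `i` shows that there is at least one cycle.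
  insert {i = i} _ _ _ _ _ _ record { cycles = zero ; cyc = cyc } with () ← cyc i
  insert {W} {U} {i} {j} {v} W⊆U i∈U j∈U i∉W j∉W i≢j
    record { f = f ; involutive = f-inv ; fixes = f-fix ; cycles = suc c ; cyc = cyc
           ; cyc-onto = onto ; cyc-f = cyc-f ; cyc-reflect = reflect ; bound = bound } = record
    { f = f′ ; involutive = f′-inv ; fixes = f′-fix ; cycles = c ; cyc = cyc′
    ; cyc-onto = onto′ ; cyc-f = cyc′-f ; cyc-reflect = reflect′ ; bound = bound′ }
    where
    fi≡i : f i ≡ i
    fi≡i = f-fix i∉W

    fj≡j : f j ≡ j
    fj≡j = f-fix j∉W

    f′ : Fin n → Fin n
    f′ x = f (PC.transpose i j x)

    f′i≡j : f′ i ≡ j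
    f′i≡j = trans (cong f (transpose-fst i j)) fj≡j

    f′j≡i : f′ j ≡ i
    f′j≡i = trans (cong f (transpose-snd i j)) fi≡i

    f′≡f : ∀ {x} → x ≢ i → x ≢ j → f′ x ≡ f x
    f′≡f x≢i x≢j = cong f (transpose-other x≢i x≢j)

    -- An involution sends only `y` itself to a fixed point `y`.
    f-avoids : ∀ {x y} → f y ≡ y → x ≢ y → f x ≢ y
    f-avoids {x} fy≡y x≢y fx≡y = x≢y (trans (sym (f-inv x)) (trans (cong f fx≡y) fy≡y))

    f′-inv : ∀ x → f′ (f′ x) ≡ x
    f′-inv x with place i j x
    ... | fst refl = trans (cong f′ f′i≡j) f′j≡i
    ... | snd refl = trans (cong f′ f′j≡i) f′i≡j
    ... | other x≢i x≢j = trans (cong f′ (f′≡f x≢i x≢j))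
      (trans (f′≡f (f-avoids fi≡i x≢i) (f-avoids fj≡j x≢j)) (f-inv x))

    f′-fix : ∀ {x} → x ∉ U → f′ x ≡ x
    f′-fix x∉U = trans (f′≡f (λ { refl → x∉U i∈U }) (λ { refl → x∉U j∈U })) (f-fix (x∉U ∘ W⊆U))

    alone : ∀ {x y} → f x ≡ x → cyc x ≡ cyc y → x ≡ y
    alone fx≡x e with reflect e
    ... | inj₁ x≡y  = x≡y
    ... | inj₂ fx≡y = trans (sym fx≡x) fx≡y

    i≁j : cyc i ≢ cyc j
    i≁j = i≢j ∘ alone fi≡i

    cyc′ : Fin n → Fin c
    cyc′ = merge i≁j ∘ cyc

    onto′ : ∀ y → ∃ λ x → cyc′ x ≡ y
    onto′ y with merge-onto i≁j y
    ... | z , mz≡y with onto z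
    ... | x , cx≡z = x , trans (cong (merge i≁j) cx≡z) mz≡y

    cyc′-f : ∀ x → cyc′ (f′ x) ≡ cyc′ x
    cyc′-f x with place i j x
    ... | fst refl = trans (cong cyc′ f′i≡j) (sym (merge-identifies i≁j))
    ... | snd refl = trans (cong cyc′ f′j≡i) (merge-identifies i≁j)
    ... | other x≢i x≢j = cong (merge i≁j) (trans (cong cyc (f′≡f x≢i x≢j)) (cyc-f x))

    reflect′ : ∀ {x y} → cyc′ x ≡ cyc′ y → x ≡ y ⊎ f′ x ≡ y
    reflect′ {x} {y} e with merge-reflect i≁j e
    ... | inj₂ (inj₁ (x~i , y~j)) with refl ← alone fi≡i (sym x~i) | refl ← alone fj≡j (sym y~j) =
      inj₂ f′i≡j
    ... | inj₂ (inj₂ (x~j , y~i)) with refl ← alone fj≡j (sym x~j) | refl ← alone fi≡i (sym y~i) =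
      inj₂ f′j≡i
    ... | inj₁ x~y with place i j x
    ...   | fst refl = inj₁ (alone fi≡i x~y)
    ...   | snd refl = inj₁ (alone fj≡j x~y)
    ...   | other x≢i x≢j with reflect x~y
    ...     | inj₁ x≡y  = inj₁ x≡y
    ...     | inj₂ fx≡y = inj₂ (trans (f′≡f x≢i x≢j) fx≡y)

    d S S′ : ℕ
    d  = δ i j
    S  = sum (tabulate (displacement f))
    S′ = sum (tabulate (displacement f′))

    stays : ∀ {x} → f x ≡ x → displacement f x ≡ 0
    stays {x} fx≡x = trans (cong (δ x) fx≡x) (δ-refl x)

    -- Intermediate between the two displacements: the term at `i` is already raised, that at `j` is
    -- not, so `sum-raise` applies at one point at a time.
    half : Fin n → ℕ
    half = updateAt (displacement f′) j (const 0)

    S+2d≤S′ : S + 2 * d ≤ S′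
    S+2d≤S′ = begin
      S + (d + (d + 0))              ≡⟨ cong (λ e → S + (d + e)) (+-identityʳ d) ⟩
      S + (d + d)                    ≡⟨ sym (+-assoc S d d) ⟩
      S + d + d                      ≡⟨ cong (λ e → S + e + d) (sym half-i) ⟩
      S + half i + d                 ≤⟨ +-monoˡ-≤ d (sum-raise i (stays fi≡i) below-half) ⟩
      sum (tabulate half) + d        ≡⟨ cong (λ e → sum (tabulate half) + e) (sym f′-at-j) ⟩
      sum (tabulate half) + displacement f′ j
        ≤⟨ sum-raise j (updateAt-updates j (displacement f′))
             (λ {x} x≢j → ≤-reflexive (updateAt-minimal x j (displacement f′) x≢j)) ⟩
      S′                             ∎
      where
      open ≤-Reasoning

      f′-at-j : displacement f′ j ≡ d
      f′-at-j = trans (cong (δ j) f′j≡i) (δ-sym j i)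

      half-i : half i ≡ d
      half-i = trans (updateAt-minimal i j (displacement f′) i≢j) (cong (δ i) f′i≡j)

      below-half : ∀ {x} → x ≢ i → displacement f x ≤ half x
      below-half {x} x≢i with x ≟ j
      ... | yes refl = ≤-trans (≤-reflexive (stays fj≡j)) z≤n
      ... | no  x≢j  = ≤-reflexive (sym
        (trans (updateAt-minimal x j (displacement f′) x≢j) (cong (δ x) (f′≡f x≢i x≢j))))

    bound′ : v + (2 * d ∸ 1) + n ≤ c + S′
    bound′ = begin
      v + (2 * d ∸ 1) + n         ≡⟨ +-assoc v _ n ⟩
      v + (2 * d ∸ 1 + n)         ≡⟨ cong (λ e → v + e) (+-comm _ n) ⟩
      v + (n + (2 * d ∸ 1))       ≡⟨ sym (+-assoc v n _) ⟩
      v + n + (2 * d ∸ 1)         ≤⟨ +-monoˡ-≤ _ bound ⟩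
      suc c + S + (2 * d ∸ 1)     ≡⟨ sym (+-suc (c + S) _) ⟩
      -- The lost cycle makes up for the subtracted 1, which is exact because `d` is positive.
      c + S + suc (2 * d ∸ 1)     ≡⟨ cong (λ e → c + S + e) (m+[n∸m]≡n {1} (≤-trans (0<δ i≢j) (m≤m+n d _))) ⟩
      c + S + 2 * d               ≡⟨ +-assoc c S _ ⟩
      c + (S + 2 * d)             ≤⟨ +-monoʳ-≤ c S+2d≤S′ ⟩
      c + S′                      ∎
      where open ≤-Reasoning

  -- Two remaining vertices form one more transposed pair, worth at least 1 as their distance is
  -- positive.
  remainder : ∀ W → ∣ W ∣ ≤ 2 → Involution W (∣ W ∣ ∸ 1)
  remainder W W≤2 with 1 <? ∣ W ∣
  ... | no W≤1 = weaken (∸-monoˡ-≤ 1 (≮⇒≥ W≤1)) (identity W)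
  ... | yes 1<W with 1<∣p∣⇒two W 1<W
  ... | a , b , a∈ , b∈ , a≢b = weaken
    (≤-trans (∸-monoˡ-≤ 1 W≤2) (∸-monoˡ-≤ 1 (*-monoʳ-≤ 2 (0<δ a≢b))))
    (insert (λ x∈⊥ → contradiction x∈⊥ ∉⊥) a∈ b∈ ∉⊥ ∉⊥ a≢b (identity ⊥))

  insert-ends : ∀ {U i j v} → 3 ≤ ∣ U ∣ → Diametral U i j →
                Involution (U - i - j) v → Involution U (v + (2 * δ i j ∸ 1))
  insert-ends {U} {i} {j} 3≤U D = insert (p-x⊆p U i ∘ p-x⊆p (U - i) j) (i∈U D) (j∈U D)
    (i∉p-i U i ∘ p-x⊆p (U - i) j) (i∉p-i (U - i) j) (diametral-≢ (≤-trans (n≤1+n 2) 3≤U) D)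

  -- Here `v` covers what the run adds after `β`. The run accumulates forwards while the involution
  -- grows from the last tree backwards, so `β` is kept apart.
  involution-of-run : ∀ {U β b} → Convex U → 3 ≤ ∣ U ∣ → Run T U β b →
                      ∃ λ v → b ≤ β + v × Involution U v
  involution-of-run {U} {β} conv 3≤U (loop {i} {j} i∈ j∈ diam dist 3≤W run)
    with refl ← induced-dist≡δ conv i∈ j∈ dist
    with D ← isDiam⇒diametral conv i∈ j∈ diam
    with involution-of-run (delete-ends conv D) 3≤W run
  ... | v , b≤ , I =
    v + (2 * δ i j ∸ 1) ,
    ≤-trans b≤ (≤-reflexive (trans (+-assoc β _ v) (cong (λ e → β + e) (+-comm _ v)))) ,
    insert-ends 3≤U D I
  involution-of-run {U} {β} conv 3≤U (stop {i} {j} i∈ j∈ diam dist W<3)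
    with refl ← induced-dist≡δ conv i∈ j∈ dist =
    ∣ U - i - j ∣ ∸ 1 + (2 * δ i j ∸ 1) ,
    ≤-reflexive (trans (+-assoc β _ _) (cong (λ e → β + e) (+-comm (2 * δ i j ∸ 1) _))) ,
    insert-ends 3≤U (isDiam⇒diametral conv i∈ j∈ diam) (remainder _ (≤-pred W<3))

  -- Values of permutations, and the upper bound for `βmax`.

  involution-value : ∀ {U b} → Involution U b → ∃ λ v → + b ≤ᶻ v × BoundValue T v
  involution-value {b = b} I =
    _ , b≤v , π , cycles , displacement f , (cyc , surjective , same-cycle) , (λ i → δ-isDist i (f i)) , refl
    where
    open Involution I

    π : Permutation′ n
    π = permutation f f involutive involutive

    surjective : Surjective _≡_ _≡_ cyc
    surjective y with cyc-onto y
    ... | x , cx≡y = x , λ { refl → cx≡y }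

    cyc-iterate : ∀ x k → cyc (iterate f x k) ≡ cyc x
    cyc-iterate x zero    = refl
    cyc-iterate x (suc k) = trans (cyc-iterate (f x) k) (cyc-f x)

    -- For an involution, zero or one application of `f` reaches the whole cycle.
    orbit : ∀ {x y} → x ≡ y ⊎ f x ≡ y → SameCycle π x y
    orbit (inj₁ x≡y)  = 0 , x≡y
    orbit (inj₂ fx≡y) = 1 , fx≡y

    same-cycle : ∀ x y → cyc x ≡ cyc y ⇔ SameCycle π x y
    same-cycle x y = mk⇔ (orbit ∘ cyc-reflect) λ { (k , refl) → sym (cyc-iterate x k) }

    S : ℕ
    S = sum (tabulate (displacement f))

    -- Subtracting `n` on both sides of `bound` gives the integer form.
    b≤v : + b ≤ᶻ + cycles ℤ.- + n ℤ.+ + S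
    b≤v = begin
      + b                            ≡⟨ sym (ℤₚ.+-identityʳ (+ b)) ⟩
      + b ℤ.+ ℤ.0ℤ                   ≡⟨ cong (λ e → + b ℤ.+ e) (sym (ℤₚ.+-inverseʳ (+ n))) ⟩
      + b ℤ.+ (+ n ℤ.- + n)          ≡⟨ sym (ℤₚ.+-assoc (+ b) (+ n) (ℤ.- + n)) ⟩
      + (b + n) ℤ.- + n              ≤⟨ ℤₚ.+-monoˡ-≤ (ℤ.- + n) (ℤ.+≤+ bound) ⟩
      + (cycles + S) ℤ.- + n         ≡⟨ ℤₚ.+-assoc (+ cycles) (+ S) (ℤ.- + n) ⟩
      + cycles ℤ.+ (+ S ℤ.- + n)     ≡⟨ cong (λ e → + cycles ℤ.+ e) (ℤₚ.+-comm (+ S) (ℤ.- + n)) ⟩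
      + cycles ℤ.+ (ℤ.- + n ℤ.+ + S) ≡⟨ sym (ℤₚ.+-assoc (+ cycles) (ℤ.- + n) (+ S)) ⟩
      + cycles ℤ.- + n ℤ.+ + S       ∎
      where open ℤₚ.≤-Reasoning

  βmax≤maximum : 3 ≤ n → ∀ {β M} → IsMaximum _≤_ (Output T) β → IsMaximum _≤ᶻ_ (BoundValue T) M →
                 + β ≤ᶻ M
  βmax≤maximum 3≤n (run , _) (_ , max)
    with involution-of-run ⊤-convex (≤-trans 3≤n (≤-reflexive (sym (∣⊤∣≡n n)))) run
  ... | v , β≤v , I with involution-value (weaken β≤v I)
  ... | w , β≤w , value = ℤₚ.≤-trans β≤w (max w value)

theorem13 : (n : ℕ) → 5 ≤ n → (T : Tree n) →
    (diamΓ : ℕ) → IsDiam (cayley (Tree.graph T)) diamΓ →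
    (βmax : ℕ) → IsMaximum _≤_ (Output T) βmax →
    (M : ℤ) → IsMaximum _≤ᶻ_ (BoundValue T) M →
    (diamΓ ≤ βmax) × (+ βmax ≤ᶻ M)
theorem13 n 5≤n T diamΓ isDiam βmax isβ M isM =
  diam≤βmax T 3≤n isDiam isβ , βmax≤maximum T 3≤n isβ isM
  where
  3≤n : 3 ≤ n
  3≤n = ≤-trans (m≤n+m 3 2) 5≤n
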